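{- There is an absolute constant $C>0$ such that, for all $\varepsilon\in(0,1]$, $\mu_1,\mu_2\ge 1$ and every instance of the $(\varepsilon,\mu_1,\mu_2)$-online estimate model, the total number of preemptions in the schedule of the algorithm Balanced MLF is at most $C\sum_j(1+\log_2p_j)$, where the sum ranges over all jobs of the instance.
   Context: Instance. A finite set of jobs; job $j$ has release time $r_j\in\mathbb Z_{\ge0}$, processing time $p_j\in\mathbb Z_{\ge1}$, estimate $\hat p_j\in\mathbb Z_{\ge1}$ with $p_j/\mu_2\le\hat p_j\le\mu_1p_j$, and threshold $q_j\in\mathbb Z_{\ge0}$ with $q_j\le(1-\varepsilon)p_j$. During each unit interval $[t,t+1]$, $t\in\mathbb Z_{\ge0}$, a single machine processes at most one released unfinished job. In a schedule, $e_j(t)$ is the number of units of processing $j$ received before time $t$; $j$ is completed when $e_j(t)=p_j$. The signal time $s_j$ is the first integer time $t\ge r_j$ with $e_j(t)=q_j$; then $\hat p_j$ is revealed. The current class of $j$ at integer time $t\ge r_j$ is $k_j(t)=\lceil\log_2(e_j(t)+1)\rceil$ if $t<s_j$, and $k_j(t)=\max\{\lceil\log_2(e_j(s_j)+1)\rceil,\,1+\lfloor\log_2\hat p_j\rfloor\}$ if $t\ge s_j$. Balanced MLF. Start with $Q^{\mathrm{on}}(-1)=Q^{\mathrm{fresh}}(-1)=\emptyset$. At each integer time $t\ge0$, with $N$ the set of jobs released at time $t$: (Balancing) put $\mathrm{On}:=Q^{\mathrm{on}}(t-1)$, $\mathrm{Fr}:=Q^{\mathrm{fresh}}(t-1)\cup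 N$. If $\min_{j\in\mathrm{Fr}}k_j(t)<\min_{j\in\mathrm{On}}k_j(t)$ (with $\min\emptyset=\infty$) and $|\mathrm{Fr}|\ge\frac14(|\mathrm{On}|+|\mathrm{Fr}|)$, move one job of minimum current class in $\mathrm{Fr}$ from $\mathrm{Fr}$ to $\mathrm{On}$. Set $A^{\mathrm{on}}(t):=\mathrm{On}$ (ongoing jobs) and $A^{\mathrm{fresh}}(t):=\mathrm{Fr}$ (fresh jobs). (Processing) If there are active jobs, process during $[t,t+1]$ the job $j(t)\in A^{\mathrm{on}}(t)$ of smallest current class. If $k_{j(t)}(t+1)>k_{j(t)}(t)$, set $Q^{\mathrm{fresh}}(t)=A^{\mathrm{fresh}}(t)\cup\{j(t)\}$ and $Q^{\mathrm{on}}(t)=A^{\mathrm{on}}(t)\setminus\{j(t)\}$; else if $j(t)$ is completed at time $t+1$, set $Q^{\mathrm{fresh}}(t)=A^{\mathrm{fresh}}(t)$ and $Q^{\mathrm{on}}(t)=A^{\mathrm{on}}(t)\setminus\{j(t)\}$; else set $Q^{\mathrm{fresh}}(t)=A^{\mathrm{fresh}}(t)$, $Q^{\mathrm{on}}(t)=A^{\mathrm{on}}(t)$. Ties are broken arbitrarily. A preemption is counted whenever a job is processed during $[t,t+1]$, is unfinished at time $t+1$, and is not processed during $[t+1,t+2]$. -}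

module Defs where

open import Data.Fin using (Fin)
open import Data.Fin.Properties using (any?) renaming (_≟_ to _≟ᶠ_)
open import Data.Fin.Subset using (Subset; ⊥; ⁅_⁆; _∈_; _∪_; _-_; ∣_∣)
import Data.Integer as ℤ
import Data.Integer.Properties as ℤ
open import Data.List using (filter; head; length; upTo)
open import Data.Maybe using (Maybe; just; nothing; maybe)
open import Data.Maybe.Properties using (≡-dec)
open import Data.Nat
open import Data.Nat.Logarithm using (⌊log₂_⌋; ⌈log₂_⌉; ⌊log₂⌋-mono-≤; ⌊log₂[2^n]⌋≡n; ⌊log₂⌊n/2⌋⌋≡⌊log₂n⌋∸1)
open import Data.Nat.Induction using (<-rec)
import Data.Nat.Properties as ℕ
import Data.Nat.Solver
open import Data.Product using (∃; ∃-syntax; _×_; _,_)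
open import Data.Rational as ℚ using (ℚ; 0ℚ; 1ℚ; ½; mkℚ)
import Data.Rational.Properties as ℚ
import Data.Rational.Unnormalised as ℚᵘ
import Data.Rational.Unnormalised.Properties as ℚᵘ
open import Data.Rational.Solver using (module +-*-Solver)
open import Data.Sum using (inj₁; inj₂)
open import Data.Vec using (tabulate)
import Data.Vec.Functional as Vector
open import Relation.Binary.PropositionalEquality
open import Relation.Nullary using (¬_; Dec; yes; no; does; ¬?; _×-dec_)
open import Relation.Unary using (Pred; Decidable)
open import Level using (0ℓ)

-- Real numbers are Cauchy sequences of rationals; two sequences denote the
-- same real when each is ≤ᴿ the other.

IsCauchy : (ℕ → ℚ) → Set
IsCauchy x = ∀ δ → 0ℚ ℚ.< δ →
  ∃[ N ] (∀ m n → N ≤ m → N ≤ n → ℚ.∣ x m ℚ.- x n ∣ ℚ.< δ)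

record ℝ : Set where
  constructor mkℝ
  field
    seq    : ℕ → ℚ
    cauchy : IsCauchy seq

open ℝ public

infix  4 _≤ᴿ_ _<ᴿ_
infixl 6 _+ᴿ_ _-ᴿ_
infixl 7 _*ᴿ_
infix  8 -ᴿ_

_≤ᴿ_ : ℝ → ℝ → Set
x ≤ᴿ y = ∀ δ → 0ℚ ℚ.< δ → ∃[ N ] (∀ n → N ≤ n → seq x n ℚ.≤ seq y n ℚ.+ δ)

_<ᴿ_ : ℝ → ℝ → Set
x <ᴿ y = ∃[ δ ] 0ℚ ℚ.< δ × ∃[ N ] (∀ n → N ≤ n → seq x n ℚ.+ δ ℚ.≤ seq y n)

half-pos : ∀ {δ} → 0ℚ ℚ.< δ → 0ℚ ℚ.< ½ ℚ.* δ
half-pos {δ} δ>0 = ℚ.*-monoʳ-<-pos ½ δ>0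

half-sum : ∀ δ → ½ ℚ.* δ ℚ.+ ½ ℚ.* δ ≡ δ
half-sum δ = trans (sym (ℚ.*-distribʳ-+ δ ½ ½)) (ℚ.*-identityˡ δ)

∣x-x∣ : ∀ q → ℚ.∣ q ℚ.- q ∣ ≡ 0ℚ
∣x-x∣ q = cong ℚ.∣_∣ (ℚ.+-inverseʳ q)

fromℚ : ℚ → ℝ
fromℚ q = mkℝ (λ _ → q) λ δ δ>0 → 0 , λ _ _ _ _ → subst (ℚ._< δ) (sym (∣x-x∣ q)) δ>0

fromℕ : ℕ → ℝ
fromℕ n = fromℚ (ℤ.+ n ℚ./ 1)

0ᴿ 1ᴿ : ℝ
0ᴿ = fromℕ 0
1ᴿ = fromℕ 1

_+ᴿ_ : ℝ → ℝ → ℝ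
x +ᴿ y = mkℝ (λ n → seq x n ℚ.+ seq y n) λ δ δ>0 →
  let M , hx = cauchy x (½ ℚ.* δ) (half-pos δ>0)
      N , hy = cauchy y (½ ℚ.* δ) (half-pos δ>0)
  in M ⊔ N , λ m n m≥ n≥ → begin-strict
    ℚ.∣ (seq x m ℚ.+ seq y m) ℚ.- (seq x n ℚ.+ seq y n) ∣
      ≡⟨ cong ℚ.∣_∣ (rearrange (seq x m) (seq y m) (seq x n) (seq y n)) ⟩
    ℚ.∣ (seq x m ℚ.- seq x n) ℚ.+ (seq y m ℚ.- seq y n) ∣
      ≤⟨ ℚ.∣p+q∣≤∣p∣+∣q∣ (seq x m ℚ.- seq x n) (seq y m ℚ.- seq y n) ⟩
    ℚ.∣ seq x m ℚ.- seq x n ∣ ℚ.+ ℚ.∣ seq y m ℚ.- seq y n ∣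
      <⟨ ℚ.+-mono-< (hx m n (ℕ.m⊔n≤o⇒m≤o M N m≥) (ℕ.m⊔n≤o⇒m≤o M N n≥))
                    (hy m n (ℕ.m⊔n≤o⇒n≤o M N m≥) (ℕ.m⊔n≤o⇒n≤o M N n≥)) ⟩
    ½ ℚ.* δ ℚ.+ ½ ℚ.* δ ≡⟨ half-sum δ ⟩
    δ ∎
  where
  open ℚ.≤-Reasoning
  rearrange : ∀ a b c d → (a ℚ.+ b) ℚ.- (c ℚ.+ d) ≡ (a ℚ.- c) ℚ.+ (b ℚ.- d)
  rearrange = solve 4 (λ a b c d → (a :+ b) :- (c :+ d) := (a :- c) :+ (b :- d)) refl
    where open +-*-Solver

-ᴿ_ : ℝ → ℝ
-ᴿ x = mkℝ (λ n → ℚ.- seq x n) λ δ δ>0 →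
  let N , h = cauchy x δ δ>0
  in N , λ m n m≥ n≥ → subst (ℚ._< δ) (cong ℚ.∣_∣ (rearrange (seq x n) (seq x m))) (h n m n≥ m≥)
  where
  rearrange : ∀ a b → a ℚ.- b ≡ (ℚ.- b) ℚ.- (ℚ.- a)
  rearrange = solve 2 (λ a b → a :- b := (:- b) :- (:- a)) refl
    where open +-*-Solver

_-ᴿ_ : ℝ → ℝ → ℝ
x -ᴿ y = x +ᴿ (-ᴿ y)

eventually-bounded : ∀ x → ∃[ B ] 0ℚ ℚ.< B × ∃[ N ] (∀ n → N ≤ n → ℚ.∣ seq x n ∣ ℚ.≤ B)
eventually-bounded x =
  let N , h = cauchy x 1ℚ 0<1
  in ℚ.∣ seq x N ∣ ℚ.+ 1ℚ , ℚ.+-mono-≤-< (ℚ.0≤∣p∣ (seq x N)) 0<1 , N , λ n n≥ → begin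
    ℚ.∣ seq x n ∣ ≡⟨ cong ℚ.∣_∣ (split (seq x n) (seq x N)) ⟩
    ℚ.∣ seq x N ℚ.+ (seq x n ℚ.- seq x N) ∣
      ≤⟨ ℚ.∣p+q∣≤∣p∣+∣q∣ (seq x N) (seq x n ℚ.- seq x N) ⟩
    ℚ.∣ seq x N ∣ ℚ.+ ℚ.∣ seq x n ℚ.- seq x N ∣
      ≤⟨ ℚ.+-monoʳ-≤ ℚ.∣ seq x N ∣ (ℚ.<⇒≤ (h n N n≥ ℕ.≤-refl)) ⟩
    ℚ.∣ seq x N ∣ ℚ.+ 1ℚ ∎
  where
  open ℚ.≤-Reasoning
  0<1 : 0ℚ ℚ.< 1ℚ
  0<1 = ℚ.positive⁻¹ 1ℚ
  split : ∀ a b → a ≡ b ℚ.+ (a ℚ.- b)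
  split = solve 2 (λ a b → a := b :+ (a :- b)) refl
    where open +-*-Solver

divide : ∀ B δ → 0ℚ ℚ.< B → 0ℚ ℚ.< δ → ∃[ η ] 0ℚ ℚ.< η × B ℚ.* η ≡ δ
divide B δ B>0 δ>0 = η , η>0 , (begin
  B ℚ.* (1/B ℚ.* δ) ≡⟨ ℚ.*-assoc B 1/B δ ⟨
  B ℚ.* 1/B ℚ.* δ   ≡⟨ cong (ℚ._* δ) (ℚ.*-inverseʳ B) ⟩
  1ℚ ℚ.* δ          ≡⟨ ℚ.*-identityˡ δ ⟩
  δ ∎)
  where
  open ≡-Reasoning
  instance
    B-pos : ℚ.Positive B
    B-pos = ℚ.positive B>0
    B-nonZero : ℚ.NonZero B
    B-nonZero = ℚ.pos⇒nonZero B
  1/B η : ℚ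
  1/B = ℚ.1/ B
  η = 1/B ℚ.* δ
  η>0 : 0ℚ ℚ.< η
  η>0 = subst (ℚ._< η) (ℚ.*-zeroʳ 1/B) (ℚ.*-monoʳ-<-pos 1/B {{ℚ.1/pos⇒pos B}} δ>0)

product-bound : ∀ {a b B η} → 0ℚ ℚ.< B → ℚ.∣ a ∣ ℚ.≤ B → ℚ.∣ b ∣ ℚ.< η → ℚ.∣ a ℚ.* b ∣ ℚ.< B ℚ.* η
product-bound {a} {b} {B} {η} B>0 a≤ b< = begin-strict
  ℚ.∣ a ℚ.* b ∣         ≡⟨ ℚ.∣p*q∣≡∣p∣*∣q∣ a b ⟩
  ℚ.∣ a ∣ ℚ.* ℚ.∣ b ∣   ≤⟨ ℚ.*-monoʳ-≤-nonNeg ℚ.∣ b ∣ {{ℚ.∣-∣-nonNeg b}} a≤ ⟩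
  B ℚ.* ℚ.∣ b ∣         <⟨ ℚ.*-monoʳ-<-pos B {{ℚ.positive B>0}} b< ⟩
  B ℚ.* η ∎
  where open ℚ.≤-Reasoning

_*ᴿ_ : ℝ → ℝ → ℝ
x *ᴿ y = mkℝ (λ n → seq x n ℚ.* seq y n) λ δ δ>0 →
  let A , A>0 , K , hA     = eventually-bounded x
      B , B>0 , L , hB     = eventually-bounded y
      α , α>0 , Aα≡δ/2     = divide A (½ ℚ.* δ) A>0 (half-pos δ>0)
      β , β>0 , Bβ≡δ/2     = divide B (½ ℚ.* δ) B>0 (half-pos δ>0)
      M , hx               = cauchy x β β>0
      N , hy               = cauchy y α α>0
  in (K ⊔ L) ⊔ (M ⊔ N) , λ m n m≥ n≥ →
    let m≥KL = ℕ.m⊔n≤o⇒m≤o (K ⊔ L) (M ⊔ N) m≥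
        n≥KL = ℕ.m⊔n≤o⇒m≤o (K ⊔ L) (M ⊔ N) n≥
        m≥MN = ℕ.m⊔n≤o⇒n≤o (K ⊔ L) (M ⊔ N) m≥
        n≥MN = ℕ.m⊔n≤o⇒n≤o (K ⊔ L) (M ⊔ N) n≥
        xm = seq x m ; xn = seq x n ; ym = seq y m ; yn = seq y n
    in begin-strict
    ℚ.∣ xm ℚ.* ym ℚ.- xn ℚ.* yn ∣
      ≡⟨ cong ℚ.∣_∣ (rearrange xm ym xn yn) ⟩
    ℚ.∣ xm ℚ.* (ym ℚ.- yn) ℚ.+ yn ℚ.* (xm ℚ.- xn) ∣
      ≤⟨ ℚ.∣p+q∣≤∣p∣+∣q∣ (xm ℚ.* (ym ℚ.- yn)) (yn ℚ.* (xm ℚ.- xn)) ⟩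
    ℚ.∣ xm ℚ.* (ym ℚ.- yn) ∣ ℚ.+ ℚ.∣ yn ℚ.* (xm ℚ.- xn) ∣
      <⟨ ℚ.+-mono-<
           (product-bound {xm} {ym ℚ.- yn} A>0 (hA m (ℕ.m⊔n≤o⇒m≤o K L m≥KL))
             (hy m n (ℕ.m⊔n≤o⇒n≤o M N m≥MN) (ℕ.m⊔n≤o⇒n≤o M N n≥MN)))
           (product-bound {yn} {xm ℚ.- xn} B>0 (hB n (ℕ.m⊔n≤o⇒n≤o K L n≥KL))
             (hx m n (ℕ.m⊔n≤o⇒m≤o M N m≥MN) (ℕ.m⊔n≤o⇒m≤o M N n≥MN))) ⟩
    A ℚ.* α ℚ.+ B ℚ.* β ≡⟨ cong₂ ℚ._+_ Aα≡δ/2 Bβ≡δ/2 ⟩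
    ½ ℚ.* δ ℚ.+ ½ ℚ.* δ ≡⟨ half-sum δ ⟩
    δ ∎
  where
  open ℚ.≤-Reasoning
  rearrange : ∀ a b c d → a ℚ.* b ℚ.- c ℚ.* d ≡ a ℚ.* (b ℚ.- d) ℚ.+ d ℚ.* (a ℚ.- c)
  rearrange = solve 4 (λ a b c d → a :* b :- c :* d := a :* (b :- d) :+ d :* (a :- c)) refl
    where open +-*-Solver

∑ : ∀ {n} → (Fin n → ℝ) → ℝ
∑ = Vector.foldr _+ᴿ_ 0ᴿ

2^⌊log₂n⌋≤n : ∀ n .{{_ : NonZero n}} → 2 ^ ⌊log₂ n ⌋ ≤ n
2^⌊log₂n⌋≤n n = <-rec (λ n → .{{NonZero n}} → 2 ^ ⌊log₂ n ⌋ ≤ n) step n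
  where
  open ℕ.≤-Reasoning
  step : ∀ n → (∀ {m} → m < n → .{{NonZero m}} → 2 ^ ⌊log₂ m ⌋ ≤ m) →
         .{{NonZero n}} → 2 ^ ⌊log₂ n ⌋ ≤ n
  step 1 rec = ℕ.≤-refl
  step n@(suc (suc n-2)) rec = begin
    2 ^ ⌊log₂ n ⌋                  ≤⟨ ℕ.^-monoʳ-≤ 2 (ℕ.m≤n+m∸n ⌊log₂ n ⌋ 1) ⟩
    2 ^ (1 + (⌊log₂ n ⌋ ∸ 1))      ≡⟨ cong (λ k → 2 ^ (1 + k)) (⌊log₂⌊n/2⌋⌋≡⌊log₂n⌋∸1 n) ⟨
    2 * 2 ^ ⌊log₂ ⌊ n /2⌋ ⌋        ≤⟨ ℕ.*-monoʳ-≤ 2 (rec (ℕ.⌊n/2⌋<n (suc n-2))) ⟩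
    2 * ⌊ n /2⌋                    ≡⟨ cong (⌊ n /2⌋ +_) (ℕ.+-identityʳ ⌊ n /2⌋) ⟩
    ⌊ n /2⌋ + ⌊ n /2⌋              ≤⟨ ℕ.+-monoʳ-≤ ⌊ n /2⌋ (ℕ.⌊n/2⌋≤⌈n/2⌉ n) ⟩
    ⌊ n /2⌋ + ⌈ n /2⌉              ≡⟨ ℕ.⌊n/2⌋+⌈n/2⌉≡n n ⟩
    n ∎

n<2^[1+⌊log₂n⌋] : ∀ n → n < 2 ^ (1 + ⌊log₂ n ⌋)
n<2^[1+⌊log₂n⌋] n = ℕ.≰⇒> λ 2^≤n → ℕ.<-irrefl refl
  (subst (_≤ ⌊log₂ n ⌋) (⌊log₂[2^n]⌋≡n (1 + ⌊log₂ n ⌋)) (⌊log₂⌋-mono-≤ 2^≤n))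

2^-cancel-≤ : ∀ a b → 2 ^ a ≤ 2 ^ b → a ≤ b
2^-cancel-≤ a b h = subst₂ _≤_ (⌊log₂[2^n]⌋≡n a) (⌊log₂[2^n]⌋≡n b) (⌊log₂⌋-mono-≤ h)

⌊log₂[p^m]⌋*n≤ : ∀ p .{{_ : NonZero p}} m n →
  ⌊log₂ (p ^ m) ⌋ * n ≤ (1 + ⌊log₂ (p ^ n) ⌋) * m
⌊log₂[p^m]⌋*n≤ p m n = 2^-cancel-≤ (a * n) ((1 + b) * m) (begin
  2 ^ (a * n)         ≡⟨ ℕ.^-*-assoc 2 a n ⟨
  (2 ^ a) ^ n         ≤⟨ ℕ.^-monoˡ-≤ n (2^⌊log₂n⌋≤n (p ^ m) {{ℕ.m^n≢0 p m}}) ⟩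
  (p ^ m) ^ n         ≡⟨ ℕ.^-*-assoc p m n ⟩
  p ^ (m * n)         ≡⟨ cong (p ^_) (ℕ.*-comm m n) ⟩
  p ^ (n * m)         ≡⟨ ℕ.^-*-assoc p n m ⟨
  (p ^ n) ^ m         ≤⟨ ℕ.^-monoˡ-≤ m (ℕ.<⇒≤ (n<2^[1+⌊log₂n⌋] (p ^ n))) ⟩
  (2 ^ (1 + b)) ^ m   ≡⟨ ℕ.^-*-assoc 2 (1 + b) m ⟩
  2 ^ ((1 + b) * m)   ∎)
  where
  open ℕ.≤-Reasoning
  a = ⌊log₂ (p ^ m) ⌋
  b = ⌊log₂ (p ^ n) ⌋

/-mono : ∀ a b m n → a * suc n ≤ b * suc m → (ℤ.+ a ℚ./ suc m) ℚ.≤ (ℤ.+ b ℚ./ suc n)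
/-mono a b m n h = ℚ.toℚᵘ-cancel-≤
  (ℚᵘ.≤-respˡ-≃ (ℚᵘ.≃-sym (ℚ.toℚᵘ-fromℚᵘ (ℚᵘ.mkℚᵘ (ℤ.+ a) m)))
  (ℚᵘ.≤-respʳ-≃ (ℚᵘ.≃-sym (ℚ.toℚᵘ-fromℚᵘ (ℚᵘ.mkℚᵘ (ℤ.+ b) n)))
  (ℚᵘ.*≤* (subst₂ ℤ._≤_ (ℤ.pos-* a (suc n)) (ℤ.pos-* b (suc m)) (ℤ.+≤+ h)))))

/-suc : ∀ b n → (ℤ.+ (1 + b) ℚ./ suc n) ≡ (ℤ.+ b ℚ./ suc n) ℚ.+ (ℤ.+ 1 ℚ./ suc n)
/-suc b n = ℚ.toℚᵘ-injective (begin
  ℚ.toℚᵘ (ℤ.+ (1 + b) ℚ./ suc n)  ≈⟨ ℚ.toℚᵘ-fromℚᵘ (ℚᵘ.mkℚᵘ (ℤ.+ (1 + b)) n) ⟩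
  ℚᵘ.mkℚᵘ (ℤ.+ (1 + b)) n          ≈⟨ ℚᵘ.*≡*
    (trans (sym (ℤ.pos-* (1 + b) (suc n * suc n)))
    (trans (cong ℤ.+_ (nat b (suc n)))
           (ℤ.pos-* (b * suc n + 1 * suc n) (suc n)))) ⟩
  ℚᵘ.mkℚᵘ (ℤ.+ (b * suc n + 1 * suc n)) (n + n * suc n)
    ≈⟨ ℚᵘ.≃-reflexive (cong (λ z → ℚᵘ.mkℚᵘ z (n + n * suc n))
         (cong₂ ℤ._+_ (ℤ.pos-* b (suc n)) (ℤ.pos-* 1 (suc n)))) ⟩
  ℚᵘ.mkℚᵘ (ℤ.+ b) n ℚᵘ.+ ℚᵘ.mkℚᵘ (ℤ.+ 1) n
    ≈⟨ ℚᵘ.+-cong (ℚ.toℚᵘ-fromℚᵘ (ℚᵘ.mkℚᵘ (ℤ.+ b) n))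
                 (ℚ.toℚᵘ-fromℚᵘ (ℚᵘ.mkℚᵘ (ℤ.+ 1) n)) ⟨
  ℚ.toℚᵘ (ℤ.+ b ℚ./ suc n) ℚᵘ.+ ℚ.toℚᵘ (ℤ.+ 1 ℚ./ suc n)
    ≈⟨ ℚ.toℚᵘ-homo-+ (ℤ.+ b ℚ./ suc n) (ℤ.+ 1 ℚ./ suc n) ⟨
  ℚ.toℚᵘ ((ℤ.+ b ℚ./ suc n) ℚ.+ (ℤ.+ 1 ℚ./ suc n)) ∎)
  where
  open ℚᵘ.≃-Reasoning
  nat : ∀ b n → (1 + b) * (n * n) ≡ (b * n + 1 * n) * n
  nat = solve 2 (λ b n → (con 1 :+ b) :* (n :* n) := (b :* n :+ con 1 :* n) :* n) refl
    where open Data.Nat.Solver.+-*-Solver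

1/[1+n]-small : ∀ δ → 0ℚ ℚ.< δ → ∃[ N ] (∀ n → N ≤ n → (ℤ.+ 1 ℚ./ suc n) ℚ.< δ)
1/[1+n]-small (mkℚ (ℤ.+ 0) d c) (ℚ.*<* (ℤ.+<+ ()))
1/[1+n]-small (mkℚ ℤ.-[1+ k ] d c) (ℚ.*<* ())
1/[1+n]-small (mkℚ (ℤ.+ suc k) d c) _ = suc d , λ n n≥ → ℚ.toℚᵘ-cancel-<
  (ℚᵘ.<-respˡ-≃ (ℚᵘ.≃-sym (ℚ.toℚᵘ-fromℚᵘ (ℚᵘ.mkℚᵘ (ℤ.+ 1) n)))
    (ℚᵘ.*<* (subst₂ ℤ._<_ (ℤ.pos-* 1 (suc d)) (ℤ.pos-* (suc k) (suc n))
      (ℤ.+<+ (begin-strict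
        1 * suc d     ≡⟨ ℕ.*-identityˡ (suc d) ⟩
        suc d         <⟨ s≤s n≥ ⟩
        suc n         ≤⟨ ℕ.m≤m+n (suc n) (k * suc n) ⟩
        suc k * suc n ∎)))))
  where open ℕ.≤-Reasoning

∣x-y∣< : ∀ {x y δ} → x ℚ.- y ℚ.< δ → y ℚ.- x ℚ.< δ → ℚ.∣ x ℚ.- y ∣ ℚ.< δ
∣x-y∣< {x} {y} {δ} x-y<δ y-x<δ with ℚ.∣p∣≡p∨∣p∣≡-p (x ℚ.- y)
... | inj₁ eq = subst (ℚ._< δ) (sym eq) x-y<δ
... | inj₂ eq = subst (ℚ._< δ) (sym (trans eq (neg x y))) y-x<δ
  where
  neg : ∀ x y → ℚ.- (x ℚ.- y) ≡ y ℚ.- x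
  neg = solve 2 (λ x y → :- (x :- y) := y :- x) refl
    where open +-*-Solver

-- Since 2^⌊log₂ (p^m)⌋ ≤ p^m < 2^(⌊log₂ (p^m)⌋ + 1), the real number log₂ p lies
-- within 1/m of ⌊log₂ (p^m)⌋ / m for every m ≥ 1.
log₂ : (p : ℕ) .{{_ : NonZero p}} → ℝ
log₂ p = mkℝ approx λ δ δ>0 →
  let N , small = 1/[1+n]-small δ δ>0
  in N , λ m n m≥ n≥ → ∣x-y∣< {approx m} {approx n} (ℚ.≤-<-trans (gap m n) (small n n≥))
                                                    (ℚ.≤-<-trans (gap n m) (small m m≥))
  where
  approx : ℕ → ℚ
  approx n = ℤ.+ ⌊log₂ (p ^ suc n) ⌋ ℚ./ suc n

  gap : ∀ m n → approx m ℚ.- approx n ℚ.≤ (ℤ.+ 1 ℚ./ suc n)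
  gap m n = begin
    approx m ℚ.- approx n
      ≤⟨ ℚ.+-monoˡ-≤ (ℚ.- approx n) (/-mono a (1 + b) m n (⌊log₂[p^m]⌋*n≤ p (suc m) (suc n))) ⟩
    (ℤ.+ (1 + b) ℚ./ suc n) ℚ.- approx n
      ≡⟨ cong (ℚ._- approx n) (/-suc b n) ⟩
    (approx n ℚ.+ (ℤ.+ 1 ℚ./ suc n)) ℚ.- approx n
      ≡⟨ cancel (approx n) (ℤ.+ 1 ℚ./ suc n) ⟩
    ℤ.+ 1 ℚ./ suc n ∎
    where
    open ℚ.≤-Reasoning
    a = ⌊log₂ (p ^ suc m) ⌋
    b = ⌊log₂ (p ^ suc n) ⌋
    cancel : ∀ x y → (x ℚ.+ y) ℚ.- x ≡ y
    cancel = solve 2 (λ x y → (x :+ y) :- x := y) refl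
      where open +-*-Solver

record Instance (ε μ₁ μ₂ : ℝ) : Set where
  field
    n : ℕ

  Job : Set
  Job = Fin n

  field
    r p p̂ q : Job → ℕ
    p≥1     : ∀ j → 1 ≤ p j
    p̂≥1     : ∀ j → 1 ≤ p̂ j
    -- p j / μ₂ ≤ p̂ j, multiplied out by μ₂ > 0
    p/μ₂≤p̂  : ∀ j → fromℕ (p j) ≤ᴿ μ₂ *ᴿ fromℕ (p̂ j)
    p̂≤μ₁p   : ∀ j → fromℕ (p̂ j) ≤ᴿ μ₁ *ᴿ fromℕ (p j)
    q≤[1-ε]p : ∀ j → fromℕ (q j) ≤ᴿ (1ᴿ -ᴿ ε) *ᴿ fromℕ (p j)

  log₂p : Job → ℝ
  log₂p j = log₂ (p j) {{>-nonZero (p≥1 j)}}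

count : ∀ {P : Pred ℕ 0ℓ} → Decidable P → ℕ → ℕ
count P? t = length (filter P? (upTo t))

-- The least s ≤ t satisfying P, if there is one.
first : ∀ {P : Pred ℕ 0ℓ} → Decidable P → ℕ → Maybe ℕ
first P? t = head (filter P? (upTo (suc t)))

module _ {ε μ₁ μ₂ : ℝ} (I : Instance ε μ₁ μ₂) where
  open Instance I

  -- σ t is the job processed during [t , t + 1], or nothing if the machine idles.
  module Timeline (σ : ℕ → Maybe Job) where

    Processed : Job → ℕ → Set
    Processed j t = σ t ≡ just j

    processed? : ∀ j t → Dec (Processed j t)
    processed? j t = ≡-dec _≟ᶠ_ (σ t) (just j)

    e : Job → ℕ → ℕ
    e j t = count (processed? j) t

    Completed : Job → ℕ → Set
    Completed j t = e j t ≡ p j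

    completed? : ∀ j t → Dec (Completed j t)
    completed? j t = e j t ≟ p j

    Active : Job → ℕ → Set
    Active j t = r j ≤ t × ¬ Completed j t

    -- just s_j if s_j ≤ t, and nothing if t < s_j or j never emits its signal.
    signalBy : Job → ℕ → Maybe ℕ
    signalBy j t = first (λ s → (r j ≤? s) ×-dec (e j s ≟ q j)) t

    class : Job → ℕ → ℕ
    class j t = maybe (λ s → ⌈log₂ (e j s + 1) ⌉ ⊔ (1 + ⌊log₂ p̂ j ⌋))
                      ⌈log₂ (e j t + 1) ⌉
                      (signalBy j t)

    PreemptedAt : ℕ → Set
    PreemptedAt t = ∃[ j ] (Processed j t × ¬ Completed j (suc t) × ¬ Processed j (suc t))

    preemptedAt? : Decidable PreemptedAt
    preemptedAt? t = any? λ j →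
      processed? j t ×-dec (¬? (completed? j (suc t)) ×-dec ¬? (processed? j (suc t)))

    -- The number of preemptions among the intervals [t , t + 1] with t < T; at most
    -- one job runs in each interval, so each contributes at most one. The total number
    -- of preemptions is at most B iff preemptions T is at most B for every T.
    preemptions : ℕ → ℕ
    preemptions T = count preemptedAt? T

  record Schedule : Set where
    field
      σ     : ℕ → Maybe Job
    open Timeline σ public
    field
      valid : ∀ j t → Processed j t → Active j t

  module _ (S : Schedule) where
    open Schedule S

    released : ℕ → Subset n
    released t = tabulate λ j → does (r j ≟ t)

    MinClass : ℕ → Subset n → Job → Set
    MinClass t A i = i ∈ A × (∀ j → j ∈ A → class i t ≤ class j t)

    -- With min ∅ = ∞, the minimum over Fr is smaller than the minimum over On iff it
    -- is attained at some i and is smaller than every class occurring in On.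
    BalanceCondition : ℕ → Subset n → Subset n → Set
    BalanceCondition t On Fr =
      (∃[ i ] (MinClass t Fr i × (∀ j → j ∈ On → class i t < class j t))) ×
      ∣ On ∣ + ∣ Fr ∣ ≤ 4 * ∣ Fr ∣

    data Balancing (t : ℕ) (On Fr : Subset n) : (Aon Afresh : Subset n) → Set where
      move : ∀ i → BalanceCondition t On Fr → MinClass t Fr i →
             Balancing t On Fr (On ∪ ⁅ i ⁆) (Fr - i)
      stay : ¬ BalanceCondition t On Fr → Balancing t On Fr On Fr

    ClassRises : Job → ℕ → Set
    ClassRises j t = class j t < class j (suc t)

    data Processing (t : ℕ) (Aon Afresh : Subset n) : (Qon Qfresh : Subset n) → Set where
      idle     : (∀ j → ¬ Active j t) → σ t ≡ nothing →
                 Processing t Aon Afresh Aon Afresh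
      rise     : ∀ j → ∃ (λ i → Active i t) → MinClass t Aon j → Processed j t →
                 ClassRises j t →
                 Processing t Aon Afresh (Aon - j) (Afresh ∪ ⁅ j ⁆)
      complete : ∀ j → ∃ (λ i → Active i t) → MinClass t Aon j → Processed j t →
                 ¬ ClassRises j t → Completed j (suc t) →
                 Processing t Aon Afresh (Aon - j) Afresh
      continue : ∀ j → ∃ (λ i → Active i t) → MinClass t Aon j → Processed j t →
                 ¬ ClassRises j t → ¬ Completed j (suc t) →
                 Processing t Aon Afresh Aon Afresh

    -- The queues are shifted by one: Qon t and Qfresh t are the queues left over from
    -- time t - 1. Ties are left open, so a schedule is produced by Balanced MLF when
    -- some way of breaking them yields it.
    record IsBalancedMLF : Set where
      field
        Qon Qfresh Aon Afresh : ℕ → Subset n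
        Qon-start    : Qon 0 ≡ ⊥
        Qfresh-start : Qfresh 0 ≡ ⊥
        balancing    : ∀ t → Balancing t (Qon t) (Qfresh t ∪ released t) (Aon t) (Afresh t)
        processing   : ∀ t → Processing t (Aon t) (Afresh t) (Qon (suc t)) (Qfresh (suc t))

{-# OPTIONS --safe #-}

-- A job leaves the ongoing queue only by completing or by a class rise, and it enters
-- with a class strictly below all others there, so ongoing jobs have distinct classes.
-- A job preempted without a class rise therefore loses the machine to a job that has
-- just been moved from the fresh to the ongoing queue, and each such move is preceded
-- by a release or a class rise of the moved job. So there are at most n + 2 R
-- preemptions, R being the number of class rises. Job j has at most 1 + ⌊log₂ p_j⌋
-- rises outside its signal and at most one at it, whatever the size of p̂_j.

module Submission where

open import Defs
open import Data.Fin as Fin using (Fin)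
open import Data.Fin.Properties using () renaming (_≟_ to _≟ᶠ_)
open import Data.Fin.Subset using (Subset; inside; outside; ⁅_⁆; _∈_; _∉_; _⊆_; _∪_; _-_; ∣_∣)
open import Data.Fin.Subset.Properties
import Data.Integer as ℤ
open import Data.List using (List; filter; head; upTo; _++_; []; _∷_; [_])
open import Data.List.Properties using (filter-++; filter-accept; filter-reject; length-++; upTo-∷ʳ)
open import Data.List.Membership.Propositional.Properties using (∈-filter⁺; ∈-upTo⁺)
open import Data.Maybe using (Maybe; just; nothing; maybe; _<∣>_)
open import Data.Maybe.Properties using (just-injective)
open import Data.Nat
open import Data.Nat.Logarithm using (⌊log₂_⌋; ⌈log₂_⌉; ⌊log₂⌋-mono-≤; ⌊log₂[2^n]⌋≡n; ⌈log₂⌉-mono-≤; ⌈log₂2^n⌉≡n)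
open import Data.Nat.Properties
open import Data.Nat.Solver using (module +-*-Solver)
open import Data.Product using (∃-syntax; _×_; _,_; proj₁; proj₂)
open import Data.Rational as ℚ using (ℚ; 0ℚ; 1ℚ)
import Data.Rational.Properties as ℚ
import Data.Rational.Solver
open import Data.Sum using (_⊎_; inj₁; inj₂; [_,_]′)
open import Data.Vec using (tabulate; _∷_; there)
open import Data.Vec.Properties using (lookup∘tabulate; lookup⇒[]=; []=⇒lookup)
open import Function using (_∘_)
open import Relation.Binary.PropositionalEquality hiding ([_])
open import Relation.Nullary using (¬_; yes; no; does; contradiction; _×-dec_)
open import Relation.Nullary.Decidable using (dec-true; from-yes)
open import Relation.Unary using (Pred; Decidable)
open import Level using (0ℓ)
open import Algebra.Properties.CommutativeMonoid.Sum +-0-commutativeMonoid using (sum; ∑-distrib-+)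

-- Sums over jobs and finite sets of jobs

sum-mono-≤ : ∀ {n} {f g : Fin n → ℕ} → (∀ i → f i ≤ g i) → sum f ≤ sum g
sum-mono-≤ {zero}  f≤g = z≤n
sum-mono-≤ {suc n} f≤g = +-mono-≤ (f≤g Fin.zero) (sum-mono-≤ (f≤g ∘ Fin.suc))

sum-mono-< : ∀ {n} {f g : Fin n → ℕ} → (∀ i → f i ≤ g i) → ∀ j → f j < g j → sum f < sum g
sum-mono-< f≤g Fin.zero    fj<gj = +-mono-<-≤ fj<gj (sum-mono-≤ (f≤g ∘ Fin.suc))
sum-mono-< f≤g (Fin.suc j) fj<gj = +-mono-≤-< (f≤g Fin.zero) (sum-mono-< (f≤g ∘ Fin.suc) j fj<gj)

n≤sum : ∀ {n} {f : Fin n → ℕ} → (∀ i → 1 ≤ f i) → n ≤ sum f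
n≤sum {zero}  1≤f = z≤n
n≤sum {suc n} 1≤f = +-mono-≤ (1≤f Fin.zero) (n≤sum (1≤f ∘ Fin.suc))

y∉p-y : ∀ {n} (p : Subset n) y → y ∉ p - y
y∉p-y (_ ∷ p) Fin.zero    ()
y∉p-y (_ ∷ p) (Fin.suc y) (there y∈) = y∉p-y p y y∈

x∈p-y⇒x∈p : ∀ {n} {p : Subset n} {x y} → x ∈ p - y → x ∈ p
x∈p-y⇒x∈p {p = p} {y = y} = p─q⊆p p ⁅ y ⁆

x∈p-y⇒x≢y : ∀ {n} {p : Subset n} {x y} → x ∈ p - y → x ≢ y
x∈p-y⇒x≢y {p = p} {y = y} x∈ refl = y∉p-y p y x∈

∪-monoˡ-⊆ : ∀ {n} {p q : Subset n} (s : Subset n) → p ⊆ q → p ∪ s ⊆ q ∪ s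
∪-monoˡ-⊆ {p = p} {q} s p⊆q x∈ = x∈p∪q⁺ ([ inj₁ ∘ p⊆q , inj₂ ]′ (x∈p∪q⁻ p s x∈))

∣p∪⁅x⁆∣≤1+∣p∣ : ∀ {n} (p : Subset n) x → ∣ p ∪ ⁅ x ⁆ ∣ ≤ suc ∣ p ∣
∣p∪⁅x⁆∣≤1+∣p∣ (inside  ∷ p) Fin.zero = s≤s (≤-trans (≤-reflexive (cong ∣_∣ (∪-identityʳ p))) (n≤1+n _))
∣p∪⁅x⁆∣≤1+∣p∣ (outside ∷ p) Fin.zero = s≤s (≤-reflexive (cong ∣_∣ (∪-identityʳ p)))
∣p∪⁅x⁆∣≤1+∣p∣ (inside  ∷ p) (Fin.suc x) = s≤s (∣p∪⁅x⁆∣≤1+∣p∣ p x)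
∣p∪⁅x⁆∣≤1+∣p∣ (outside ∷ p) (Fin.suc x) = ∣p∪⁅x⁆∣≤1+∣p∣ p x

module _ {n} {P : Pred (Fin n) 0ℓ} (P? : Decidable P) where

  ∈-tabulate⁺ : ∀ {i} → P i → i ∈ tabulate (does ∘ P?)
  ∈-tabulate⁺ {i} Pi =
    lookup⇒[]= i _ (trans (lookup∘tabulate _ i) (dec-true (P? i) Pi))

  ∈-tabulate⁻ : ∀ {i} → i ∈ tabulate (does ∘ P?) → P i
  ∈-tabulate⁻ {i} i∈ with P? i | trans (sym (lookup∘tabulate (does ∘ P?) i)) ([]=⇒lookup i∈)
  ... | yes Pi | _ = Pi

-- Counts and first occurrences as time advances

module _ {P : Pred ℕ 0ℓ} (P? : Decidable P) where

  filter-upTo-suc : ∀ t → filter P? (upTo (suc t)) ≡ filter P? (upTo t) ++ filter P? [ t ]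
  filter-upTo-suc t = trans (cong (filter P?) (sym (upTo-∷ʳ t))) (filter-++ P? (upTo t) [ t ])

  count-accept : ∀ {t} → P t → count P? (suc t) ≡ suc (count P? t)
  count-accept {t} Pt rewrite filter-upTo-suc t | filter-accept P? {xs = []} Pt
    | length-++ (filter P? (upTo t)) {[ t ]} = +-comm _ 1

  count-reject : ∀ {t} → ¬ P t → count P? (suc t) ≡ count P? t
  count-reject {t} ¬Pt rewrite filter-upTo-suc t | filter-reject P? {xs = []} ¬Pt
    | length-++ (filter P? (upTo t)) {[]} = +-identityʳ _

  count-suc≤ : ∀ t → count P? (suc t) ≤ suc (count P? t)
  count-suc≤ t with P? t
  ... | yes Pt = ≤-reflexive (count-accept Pt)
  ... | no ¬Pt = ≤-trans (≤-reflexive (count-reject ¬Pt)) (n≤1+n _)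

  head-++ : ∀ (xs ys : List ℕ) → head (xs ++ ys) ≡ (head xs <∣> head ys)
  head-++ []       ys = refl
  head-++ (x ∷ xs) ys = refl

  first-suc : ∀ t → first P? (suc t) ≡ (first P? t <∣> head (filter P? [ suc t ]))
  first-suc t = trans (cong head (filter-upTo-suc (suc t))) (head-++ (filter P? (upTo (suc t))) _)

  first-nothing : ∀ t → first P? t ≡ nothing → ¬ P t
  first-nothing t eq Pt
    with filter P? (upTo (suc t)) | ∈-filter⁺ P? (∈-upTo⁺ (n<1+n t)) Pt | eq
  ... | []    | () | _
  ... | _ ∷ _ | _  | ()

  -- The times satisfying `P` up to `t` form a prefix of those up to `suc t`, so a first occurrence
  -- never changes once it exists. For the signal of a job, the cases are: emitted earlier, emitted
  -- exactly at `suc t`, not yet emitted.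
  data FirstStep (t : ℕ) : Set where
    kept  : ∀ {s} → first P? t ≡ just s  → first P? (suc t) ≡ just s → FirstStep t
    found : first P? t ≡ nothing → first P? (suc t) ≡ just (suc t) → P (suc t) → FirstStep t
    none  : first P? t ≡ nothing → first P? (suc t) ≡ nothing → FirstStep t

  firstStep : ∀ t → FirstStep t
  firstStep t with first P? t in eq | first-suc t
  ... | just s  | eq′ = kept eq eq′
  ... | nothing | eq′ with P? (suc t)
  ...   | yes P1+t = found eq eq′ P1+t
  ...   | no  _    = none eq eq′

-- Received processing, classes and levels

⌈log₂[1+p]⌉≤1+⌊log₂p⌋ : ∀ p → ⌈log₂ (p + 1) ⌉ ≤ 1 + ⌊log₂ p ⌋
⌈log₂[1+p]⌉≤1+⌊log₂p⌋ p = begin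
  -- The power of two lies strictly above `p`, hence is at least `p + 1`.
  ⌈log₂ (p + 1) ⌉               ≤⟨ ⌈log₂⌉-mono-≤ (≤-trans (≤-reflexive (+-comm p 1)) (n<2^[1+⌊log₂n⌋] p)) ⟩
  ⌈log₂ (2 ^ (1 + ⌊log₂ p ⌋)) ⌉ ≡⟨ ⌈log₂2^n⌉≡n (1 + ⌊log₂ p ⌋) ⟩
  1 + ⌊log₂ p ⌋                 ∎
  where open ≤-Reasoning

module _ {ε μ₁ μ₂ : ℝ} {I : Instance ε μ₁ μ₂} (S : Schedule I) where
  open Instance I
  open Schedule S

  e-processed : ∀ {j t} → Processed j t → e j (suc t) ≡ suc (e j t)
  e-processed {j} = count-accept (processed? j)

  e-unprocessed : ∀ {j t} → ¬ Processed j t → e j (suc t) ≡ e j t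
  e-unprocessed {j} = count-reject (processed? j)

  e-mono : ∀ j t → e j t ≤ e j (suc t)
  e-mono j t with processed? j t
  ... | yes h = ≤-trans (n≤1+n _) (≤-reflexive (sym (e-processed h)))
  ... | no ¬h = ≤-reflexive (sym (e-unprocessed ¬h))

  -- A processed job is active by `valid`, so `e` differs from `p` before each increment.
  e≤p : ∀ j t → e j t ≤ p j
  e≤p j zero = z≤n
  e≤p j (suc t) with processed? j t
  ... | yes h = ≤-trans (≤-reflexive (e-processed h)) (≤∧≢⇒< (e≤p j t) (proj₂ (valid j t h)))
  ... | no ¬h = ≤-trans (≤-reflexive (e-unprocessed ¬h)) (e≤p j t)

  signalled? : ∀ j → Decidable (λ s → r j ≤ s × e j s ≡ q j)
  signalled? j s = (r j ≤? s) ×-dec (e j s ≟ q j)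

  signalStep : ∀ j t → FirstStep (signalled? j) t
  signalStep j = firstStep (signalled? j)

  ⌈log₂e⌉-mono : ∀ j t → ⌈log₂ (e j t + 1) ⌉ ≤ ⌈log₂ (e j (suc t) + 1) ⌉
  ⌈log₂e⌉-mono j t = ⌈log₂⌉-mono-≤ (+-monoˡ-≤ 1 (e-mono j t))

  -- The class is frozen after the signal. At the signal it cannot drop, since the estimate enters
  -- through a maximum with the logarithm of the received processing.
  class-mono : ∀ j t → class j t ≤ class j (suc t)
  class-mono j t with signalStep j t
  ... | kept  eq eq′   rewrite eq | eq′ = ≤-refl
  ... | found eq eq′ _ rewrite eq | eq′ = ≤-trans (⌈log₂e⌉-mono j t) (m≤m⊔n _ _)
  ... | none  eq eq′   rewrite eq | eq′ = ⌈log₂e⌉-mono j t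

  -- Without processing, a signal at `suc t` would have come at `t` already. This uses `r j ≤ t`: a
  -- job with `q j = 0` emits its signal on release, with no processing at all.
  class-unprocessed : ∀ {j t} → r j ≤ t → ¬ Processed j t → class j (suc t) ≡ class j t
  class-unprocessed {j} {t} r≤t ¬h with signalStep j t
  ... | kept  eq eq′   rewrite eq | eq′ = refl
  ... | found eq eq′ (_ , e≡q) =
    contradiction (r≤t , trans (sym (e-unprocessed ¬h)) e≡q) (first-nothing (signalled? j) t eq)
  ... | none  eq eq′   rewrite eq | eq′ = cong (λ x → ⌈log₂ (x + 1) ⌉) (e-unprocessed ¬h)

  -- Unlike the class, whose jump at the signal is as large as p̂ makes it, the level
  -- grows by only one there, so it counts class rises and is bounded in terms of p.
  level : Job → ℕ → ℕ
  level j t = maybe (λ _ → 1) 0 (signalBy j t) + ⌈log₂ (e j t + 1) ⌉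

  level-mono : ∀ j t → level j t ≤ level j (suc t)
  level-mono j t with signalStep j t
  ... | kept  eq eq′   rewrite eq | eq′ = s≤s (⌈log₂e⌉-mono j t)
  ... | found eq eq′ _ rewrite eq | eq′ = m≤n⇒m≤1+n (⌈log₂e⌉-mono j t)
  ... | none  eq eq′   rewrite eq | eq′ = ⌈log₂e⌉-mono j t

  -- Before the signal, level and class agree; at the signal, the first summand of the level goes
  -- from 0 to 1; afterwards the class cannot rise.
  level-rise : ∀ j t → ClassRises I S j t → level j t < level j (suc t)
  level-rise j t rises with signalStep j t
  ... | kept  eq eq′   rewrite eq | eq′ = contradiction rises (<-irrefl refl)
  ... | found eq eq′ _ rewrite eq | eq′ = s≤s (⌈log₂e⌉-mono j t)
  ... | none  eq eq′   rewrite eq | eq′ = rises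

  level≤2+⌊log₂p⌋ : ∀ j t → level j t ≤ 2 + ⌊log₂ p j ⌋
  level≤2+⌊log₂p⌋ j t = +-mono-≤ (signal≤1 (signalBy j t))
    (≤-trans (⌈log₂⌉-mono-≤ (+-monoˡ-≤ 1 (e≤p j t))) (⌈log₂[1+p]⌉≤1+⌊log₂p⌋ (p j)))
    where
    signal≤1 : ∀ (s : Maybe ℕ) → maybe (λ _ → 1) 0 s ≤ 1
    signal≤1 (just _) = ≤-refl
    signal≤1 nothing  = z≤n

  -- A single step of Balanced MLF

  module _ {t : ℕ} where

    balancing-⊆ : ∀ {On Fr Aon Afr j} → Balancing I S t On Fr Aon Afr →
                  j ∈ Aon ⊎ j ∈ Afr → j ∈ On ⊎ j ∈ Fr
    balancing-⊆ {On} (move i _ (i∈Fr , _)) (inj₁ j∈) with x∈p∪q⁻ On ⁅ i ⁆ j∈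
    ... | inj₁ j∈On = inj₁ j∈On
    ... | inj₂ j∈i rewrite x∈⁅y⁆⇒x≡y i j∈i = inj₂ i∈Fr
    balancing-⊆ (move i _ _) (inj₂ j∈) = inj₂ (x∈p-y⇒x∈p j∈)
    balancing-⊆ (stay _) j∈ = j∈

    processing-⊆ : ∀ {Aon Afr Qon Qfr j} → Processing I S t Aon Afr Qon Qfr →
                   j ∈ Qon ⊎ j ∈ Qfr → j ∈ Aon ⊎ j ∈ Afr
    processing-⊆ (idle _ _) j∈ = j∈
    processing-⊆ (rise _ _ _ _ _) (inj₁ j∈) = inj₁ (x∈p-y⇒x∈p j∈)
    processing-⊆ {Afr = Afr} (rise i _ (i∈ , _) _ _) (inj₂ j∈) with x∈p∪q⁻ Afr ⁅ i ⁆ j∈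
    ... | inj₁ j∈Afr = inj₂ j∈Afr
    ... | inj₂ j∈i rewrite x∈⁅y⁆⇒x≡y i j∈i = inj₁ i∈
    processing-⊆ (complete _ _ _ _ _ _) (inj₁ j∈) = inj₁ (x∈p-y⇒x∈p j∈)
    processing-⊆ (complete _ _ _ _ _ _) (inj₂ j∈) = inj₂ j∈
    processing-⊆ (continue _ _ _ _ _ _) j∈ = j∈

  unique-processed : ∀ {i j t} → Processed i t → Processed j t → i ≡ j
  unique-processed hi hj = just-injective (trans (sym hi) hj)

  DistinctClasses : ℕ → Subset n → Set
  DistinctClasses t A = ∀ i j → i ∈ A → j ∈ A → class i t ≡ class j t → i ≡ j

  -- The moved job `k` has class at most that of the witness `m` of the balance condition, and `m`
  -- is strictly below every class in `On`.
  balancing-distinct : ∀ {t On Fr Aon Afr} → Balancing I S t On Fr Aon Afr →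
                       DistinctClasses t On → DistinctClasses t Aon
  balancing-distinct (stay _) distinct = distinct
  balancing-distinct {t} {On} (move k ((m , (m∈Fr , _) , m<On) , _) (_ , k≤Fr)) distinct i j i∈ j∈ eq
    with x∈p∪q⁻ On ⁅ k ⁆ i∈ | x∈p∪q⁻ On ⁅ k ⁆ j∈
  ... | inj₁ i∈On | inj₁ j∈On = distinct i j i∈On j∈On eq
  ... | inj₂ i∈k  | inj₂ j∈k  = trans (x∈⁅y⁆⇒x≡y k i∈k) (sym (x∈⁅y⁆⇒x≡y k j∈k))
  ... | inj₁ i∈On | inj₂ j∈k  rewrite x∈⁅y⁆⇒x≡y k j∈k =
    contradiction (sym eq) (<⇒≢ (≤-<-trans (k≤Fr m m∈Fr) (m<On i i∈On)))
  ... | inj₂ i∈k  | inj₁ j∈On rewrite x∈⁅y⁆⇒x≡y k i∈k =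
    contradiction eq (<⇒≢ (≤-<-trans (k≤Fr m m∈Fr) (m<On j j∈On)))

  -- A job whose class rises leaves the ongoing queue, so those that remain either were not
  -- processed or were processed without a rise. This carries distinctness of classes to the next
  -- time.
  ongoing-class : ∀ {t Aon Afr Qon Qfr} → Processing I S t Aon Afr Qon Qfr →
                  (∀ {j} → j ∈ Aon → r j ≤ t) →
                  ∀ {j} → j ∈ Qon → j ∈ Aon × class j (suc t) ≡ class j t
  ongoing-class (idle _ σ≡nothing) r≤t j∈ =
    j∈ , class-unprocessed (r≤t j∈) (λ h → contradiction (trans (sym h) σ≡nothing) λ ())
  ongoing-class (rise _ _ _ h _) r≤t j∈ =
    x∈p-y⇒x∈p j∈ ,
    class-unprocessed (r≤t (x∈p-y⇒x∈p j∈)) (λ h′ → x∈p-y⇒x≢y j∈ (unique-processed h′ h))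
  ongoing-class (complete _ _ _ h _ _) r≤t j∈ =
    x∈p-y⇒x∈p j∈ ,
    class-unprocessed (r≤t (x∈p-y⇒x∈p j∈)) (λ h′ → x∈p-y⇒x≢y j∈ (unique-processed h′ h))
  ongoing-class {t} (continue i _ _ h ¬rises _) r≤t {j} j∈ with j ≟ᶠ i
  ... | yes refl = j∈ , ≤-antisym (≮⇒≥ ¬rises) (class-mono i t)
  ... | no j≢i   = j∈ , class-unprocessed (r≤t j∈) (λ h′ → j≢i (unique-processed h′ h))

  active⇒processes-min : ∀ {t Aon Afr Qon Qfr i} → Processing I S t Aon Afr Qon Qfr →
                         Active i t → ∃[ j ] (MinClass I S t Aon j × Processed j t)
  active⇒processes-min (idle inactive _)        active = contradiction active (inactive _)
  active⇒processes-min (rise j _ min h _)       _      = j , min , h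
  active⇒processes-min (complete j _ min h _ _) _      = j , min , h
  active⇒processes-min (continue j _ min h _ _) _      = j , min , h

  -- Runs of the algorithm: queue invariants and the charging of preemptions

  pending : ℕ → Subset n
  pending t = tabulate (λ j → does (t ≤? r j))

  module _ (B : IsBalancedMLF I S) where
    open IsBalancedMLF B

    released-fresh : ∀ {t j} → j ∈ Qfresh t ∪ released I S t → j ∈ Qfresh t ⊎ r j ≡ t
    released-fresh {t} j∈ with x∈p∪q⁻ (Qfresh t) (released I S t) j∈
    ... | inj₁ j∈Q = inj₁ j∈Q
    ... | inj₂ j∈R = inj₂ (∈-tabulate⁻ (λ j → r j ≟ t) j∈R)

    -- Simultaneous induction on time: a job enters the queues only through `released`, and each
    -- step merely redistributes the jobs. This supplies the hypothesis `r j ≤ t` of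
    -- `class-unprocessed`.
    released-A : ∀ t {j} → j ∈ Aon t ⊎ j ∈ Afresh t → r j ≤ t
    released-Fr : ∀ t {j} → j ∈ Qfresh t ∪ released I S t → r j ≤ t
    released-Q : ∀ t {j} → j ∈ Qon t ⊎ j ∈ Qfresh t → r j ≤ t
    released-A t j∈ with balancing-⊆ (balancing t) j∈
    ... | inj₁ j∈On = released-Q t (inj₁ j∈On)
    ... | inj₂ j∈Fr = released-Fr t j∈Fr
    released-Fr t j∈ with released-fresh j∈
    ... | inj₁ j∈Q = released-Q t (inj₂ j∈Q)
    ... | inj₂ r≡t = ≤-reflexive r≡t
    released-Q zero (inj₁ j∈) = contradiction (subst (_ ∈_) Qon-start j∈) ∉⊥
    released-Q zero (inj₂ j∈) = contradiction (subst (_ ∈_) Qfresh-start j∈) ∉⊥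
    released-Q (suc t) j∈ = m≤n⇒m≤1+n (released-A t (processing-⊆ (processing t) j∈))

    distinct-A : ∀ t → DistinctClasses t (Aon t)
    distinct-Q : ∀ t → DistinctClasses t (Qon t)
    distinct-A t = balancing-distinct (balancing t) (distinct-Q t)
    distinct-Q zero i _ i∈ = contradiction (subst (i ∈_) Qon-start i∈) ∉⊥
    distinct-Q (suc t) i j i∈ j∈ eq =
      let stays         = ongoing-class (processing t) (released-A t ∘ inj₁)
          i∈A , i-class = stays i∈
          j∈A , j-class = stays j∈
      in distinct-A t i j i∈A j∈A (trans (sym i-class) (trans eq j-class))

    -- The unfinished job `j` keeps the machine busy at `suc t`. If `i` runs then, minimality at
    -- both times and the absence of a rise of `j` squeeze the classes of `i` and `j` at `t` to
    -- equality, and ongoing classes are distinct.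
    not-preempted : ∀ {t j} → MinClass I S t (Aon t) j → Processed j t →
                    ¬ ClassRises I S j t → Aon (suc t) ≡ Aon t → ¬ PreemptedAt t
    not-preempted {t} {j} (j∈ , j-min) h ¬rises Aon≡ (j′ , h′ , ¬done , ¬next)
      rewrite unique-processed h′ h
      with active⇒processes-min (processing (suc t)) (m≤n⇒m≤1+n (proj₁ (valid j t h)) , ¬done)
    ... | i , (i∈ , i-min) , i-next =
      ¬next (subst (λ k → Processed k (suc t)) i≡j i-next)
      where
      i∈A : i ∈ Aon t
      i∈A = subst (i ∈_) Aon≡ i∈
      i≤j : class i t ≤ class j t
      i≤j = begin
        class i t       ≤⟨ class-mono i t ⟩
        class i (suc t) ≤⟨ i-min j (subst (j ∈_) (sym Aon≡) j∈) ⟩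
        class j (suc t) ≤⟨ ≮⇒≥ ¬rises ⟩
        class j t       ∎
        where open ≤-Reasoning
      i≡j : i ≡ j
      i≡j = distinct-A t i j i∈A j∈ (≤-antisym i≤j (j-min i i∈A))

    -- Jobs with a pending release count as fresh from the start, so that releases do not
    -- increase the number of fresh jobs and each move decreases it.
    before-balancing after-balancing : ℕ → Subset n
    before-balancing t = Qfresh t ∪ pending t
    after-balancing  t = Afresh t ∪ pending (suc t)

    -- A job released at `t` already belongs to `pending t`, so its release only shifts it from one
    -- part of the union to the other.
    released-⊆ : ∀ t → (Qfresh t ∪ released I S t) ∪ pending (suc t) ⊆ before-balancing t
    released-⊆ t {j} j∈ with x∈p∪q⁻ (Qfresh t ∪ released I S t) (pending (suc t)) j∈
    ... | inj₂ j∈P = x∈p∪q⁺ (inj₂ (∈-tabulate⁺ (λ j → t ≤? r j)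
                       (<⇒≤ (∈-tabulate⁻ (λ j → suc t ≤? r j) j∈P))))
    ... | inj₁ j∈Fr with released-fresh j∈Fr
    ...   | inj₁ j∈Q = x∈p∪q⁺ (inj₁ j∈Q)
    ...   | inj₂ r≡t = x∈p∪q⁺ (inj₂ (∈-tabulate⁺ (λ j → t ≤? r j) (≤-reflexive (sym r≡t))))

    balancing-cases : ∀ t → (Aon t ≡ Qon t × ∣ after-balancing t ∣ ≤ ∣ before-balancing t ∣)
                          ⊎ ∣ after-balancing t ∣ < ∣ before-balancing t ∣
    balancing-cases t = cases (balancing t) refl refl
      where
      cases : ∀ {Fr Aon′ Afr} → Balancing I S t (Qon t) Fr Aon′ Afr →
              Fr ≡ Qfresh t ∪ released I S t → Afr ≡ Afresh t →
              (Aon′ ≡ Qon t × ∣ after-balancing t ∣ ≤ ∣ before-balancing t ∣)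
                ⊎ ∣ after-balancing t ∣ < ∣ before-balancing t ∣
      cases (stay _) Fr≡ Afr≡ = inj₁ (refl , p⊆q⇒∣p∣≤∣q∣ (released-⊆ t ∘
        subst (λ A → _ ∈ A ∪ pending (suc t)) (trans (sym Afr≡) Fr≡)))
      cases (move i _ (i∈Fr , _)) refl Afr≡ = inj₂ (p⊂q⇒∣p∣<∣q∣
        ( released-⊆ t ∘ ∪-monoˡ-⊆ (pending (suc t)) (x∈p-y⇒x∈p ∘ subst (_ ∈_) (sym Afr≡))
        , i , released-⊆ t (x∈p∪q⁺ (inj₁ i∈Fr)) , i∉))
        where
        -- This makes the decrease strict: the moved job is deleted from the fresh jobs, and having
        -- been released by time `t` it is not pending either.
        i∉ : i ∉ after-balancing t
        i∉ i∈ with x∈p∪q⁻ (Afresh t) (pending (suc t)) i∈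
        ... | inj₁ i∈A = x∈p-y⇒x≢y (subst (i ∈_) (sym Afr≡) i∈A) refl
        ... | inj₂ i∈P = <⇒≱ (∈-tabulate⁻ (λ j → suc t ≤? r j) i∈P) (released-Fr t i∈Fr)

    -- A class rise is the only event that adds a fresh job. In its absence, a preemption at `t`
    -- needs a change of the ongoing set by the balancing at `suc t`.
    processing-cases : ∀ t →
      (∃[ j ] ClassRises I S j t × ∣ before-balancing (suc t) ∣ ≤ suc ∣ after-balancing t ∣)
        ⊎ (∣ before-balancing (suc t) ∣ ≤ ∣ after-balancing t ∣ ×
           (Aon (suc t) ≡ Qon (suc t) → ¬ PreemptedAt t))
    processing-cases t = cases (processing t) refl refl
      where
      fresh-kept : Afresh t ≡ Qfresh (suc t) →
                   ∣ before-balancing (suc t) ∣ ≤ ∣ after-balancing t ∣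
      fresh-kept Afr≡Qfr = ≤-reflexive (cong (λ A → ∣ A ∪ pending (suc t) ∣) (sym Afr≡Qfr))
      cases : ∀ {Qon′ Qfr′} → Processing I S t (Aon t) (Afresh t) Qon′ Qfr′ →
        Qon′ ≡ Qon (suc t) → Qfr′ ≡ Qfresh (suc t) →
        (∃[ j ] ClassRises I S j t × ∣ before-balancing (suc t) ∣ ≤ suc ∣ after-balancing t ∣)
          ⊎ (∣ before-balancing (suc t) ∣ ≤ ∣ after-balancing t ∣ ×
             (Aon (suc t) ≡ Qon (suc t) → ¬ PreemptedAt t))
      cases (idle _ σ≡nothing) _ Qfr≡ = inj₂ (fresh-kept Qfr≡ ,
        λ _ (_ , h , _) → contradiction (trans (sym h) σ≡nothing) λ ())
      cases (complete j _ _ h _ done) _ Qfr≡ = inj₂ (fresh-kept Qfr≡ ,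
        λ _ (_ , h′ , ¬done , _) →
          ¬done (subst (λ k → Completed k (suc t)) (unique-processed h h′) done))
      cases (continue j _ min h ¬rises _) Qon≡ Qfr≡ = inj₂ (fresh-kept Qfr≡ ,
        λ stayed → not-preempted min h ¬rises (trans stayed (sym Qon≡)))
      cases (rise j _ _ _ rises) _ Qfr≡ = inj₁ (j , rises , (begin
        ∣ Qfresh (suc t) ∪ P ∣      ≡⟨ cong (λ A → ∣ A ∪ P ∣) Qfr≡ ⟨
        ∣ (Afresh t ∪ ⁅ j ⁆) ∪ P ∣  ≡⟨ cong ∣_∣ (∪-assoc (Afresh t) ⁅ j ⁆ P) ⟩
        ∣ Afresh t ∪ (⁅ j ⁆ ∪ P) ∣  ≡⟨ cong (λ A → ∣ Afresh t ∪ A ∣) (∪-comm ⁅ j ⁆ P) ⟩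
        ∣ Afresh t ∪ (P ∪ ⁅ j ⁆) ∣  ≡⟨ cong ∣_∣ (∪-assoc (Afresh t) P ⁅ j ⁆) ⟨
        ∣ (Afresh t ∪ P) ∪ ⁅ j ⁆ ∣  ≤⟨ ∣p∪⁅x⁆∣≤1+∣p∣ (Afresh t ∪ P) j ⟩
        suc ∣ Afresh t ∪ P ∣        ∎))
        where
        open ≤-Reasoning
        P = pending (suc t)

    after≤before : ∀ t → ∣ after-balancing t ∣ ≤ ∣ before-balancing t ∣
    after≤before t = [ proj₂ , <⇒≤ ]′ (balancing-cases t)

    totalLevel : ℕ → ℕ
    totalLevel t = sum (λ j → level j t)

    -- Each fresh or pending job holds one credit; there are at most `n` at the start. A class rise
    -- brings two credits, one for a possible preemption at that time and one for the job that
    -- becomes fresh again. Any other preemption is paid by the job moved at the next balancing.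
    -- Whether a preemption occurs at `t` depends on who runs at `suc t`, so the count before `T` is
    -- paired with the fresh jobs after the balancing at `T`.
    preemptions+fresh≤ : ∀ T →
      preemptions T + ∣ after-balancing T ∣ ≤ n + 2 * totalLevel T
    preemptions+fresh≤ zero = m≤n⇒m≤n+o _ (∣p∣≤n (after-balancing 0))
    preemptions+fresh≤ (suc t) with processing-cases t
    ... | inj₁ (j , rises , before≤) = begin
      preemptions (suc t) + ∣ after-balancing (suc t) ∣
        ≤⟨ +-mono-≤ (count-suc≤ preemptedAt? t) (≤-trans (after≤before (suc t)) before≤) ⟩
      suc (preemptions t) + suc ∣ after-balancing t ∣
        ≡⟨ cong suc (+-suc (preemptions t) ∣ after-balancing t ∣) ⟩
      2 + (preemptions t + ∣ after-balancing t ∣)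
        ≤⟨ +-monoʳ-≤ 2 (preemptions+fresh≤ t) ⟩
      2 + (n + 2 * totalLevel t)
        ≡⟨ rearrange n (totalLevel t) ⟩
      n + 2 * suc (totalLevel t)
        ≤⟨ +-monoʳ-≤ n (*-monoʳ-≤ 2 (sum-mono-< (λ i → level-mono i t) j (level-rise j t rises))) ⟩
      n + 2 * totalLevel (suc t) ∎
      where
      open ≤-Reasoning
      rearrange : ∀ a b → 2 + (a + 2 * b) ≡ a + 2 * suc b
      rearrange = solve 2 (λ a b → con 2 :+ (a :+ con 2 :* b) := a :+ con 2 :* (con 1 :+ b)) refl
        where open +-*-Solver
    ... | inj₂ (before≤ , unmoved) = begin
      preemptions (suc t) + ∣ after-balancing (suc t) ∣
        ≤⟨ paid ⟩
      preemptions t + ∣ after-balancing t ∣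
        ≤⟨ preemptions+fresh≤ t ⟩
      n + 2 * totalLevel t
        ≤⟨ +-monoʳ-≤ n (*-monoʳ-≤ 2 (sum-mono-≤ (λ i → level-mono i t))) ⟩
      n + 2 * totalLevel (suc t) ∎
      where
      open ≤-Reasoning
      paid : preemptions (suc t) + ∣ after-balancing (suc t) ∣
               ≤ preemptions t + ∣ after-balancing t ∣
      paid with preemptedAt? t
      ... | no ¬preempted rewrite count-reject preemptedAt? ¬preempted =
        +-monoʳ-≤ (preemptions t) (≤-trans (after≤before (suc t)) before≤)
      -- The set of ongoing jobs must have changed at `suc t`, so a move took place, and the fresh
      -- job it used up offsets the preemption.
      ... | yes preempted rewrite count-accept preemptedAt? preempted with balancing-cases (suc t)
      ...   | inj₁ (stayed , _) = contradiction preempted (unmoved stayed)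
      ...   | inj₂ moved = ≤-trans (≤-reflexive (sym (+-suc (preemptions t) _)))
                (+-monoʳ-≤ (preemptions t) (≤-trans moved before≤))

    -- The 5 is 1 + 2 · 2: each summand of `Σ` is at least 1, which bounds `n`, and each level is at
    -- most twice its summand, as 2 + L ≤ 2(1 + L).
    preemptions≤ : ∀ T → preemptions T ≤ 5 * sum (λ j → 1 + ⌊log₂ p j ⌋)
    preemptions≤ T = begin
      preemptions T                         ≤⟨ m+n≤o⇒m≤o (preemptions T) (preemptions+fresh≤ T) ⟩
      n + 2 * totalLevel T                  ≤⟨ +-mono-≤ n≤Σ (*-monoʳ-≤ 2 totalLevel≤2Σ) ⟩
      Σ + 2 * (Σ + Σ)                       ≡⟨ collect Σ ⟩
      5 * Σ                                 ∎
      where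
      open ≤-Reasoning
      Σ = sum (λ j → 1 + ⌊log₂ p j ⌋)
      n≤Σ : n ≤ Σ
      n≤Σ = n≤sum (λ _ → s≤s z≤n)
      totalLevel≤2Σ : totalLevel T ≤ Σ + Σ
      totalLevel≤2Σ = begin
        totalLevel T
          ≤⟨ sum-mono-≤ (λ j → ≤-trans (level≤2+⌊log₂p⌋ j T)
               (s≤s (m≤n+m (1 + ⌊log₂ p j ⌋) ⌊log₂ p j ⌋))) ⟩
        sum (λ j → (1 + ⌊log₂ p j ⌋) + (1 + ⌊log₂ p j ⌋))
          ≡⟨ ∑-distrib-+ (λ j → 1 + ⌊log₂ p j ⌋) (λ j → 1 + ⌊log₂ p j ⌋) ⟩
        Σ + Σ ∎
      collect : ∀ s → s + 2 * (s + s) ≡ 5 * s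
      collect = solve 1 (λ s → s :+ con 2 :* (s :+ s) := con 5 :* s) refl
        where open +-*-Solver

-- From natural numbers to the reals

infix 8 _/1

_/1 : ℕ → ℚ
k /1 = ℤ.+ k ℚ./ 1

/1-mono : ∀ {a b} → a ≤ b → (a /1) ℚ.≤ (b /1)
/1-mono {a} {b} a≤b = /-mono a b 0 0 (*-monoˡ-≤ 1 a≤b)

/1-homo-+ : ∀ a b → (a + b) /1 ≡ a /1 ℚ.+ b /1
/1-homo-+ zero    b = sym (ℚ.+-identityˡ (b /1))
/1-homo-+ (suc a) b = begin
  (1 + (a + b)) /1         ≡⟨ /-suc (a + b) 0 ⟩
  (a + b) /1 ℚ.+ 1ℚ        ≡⟨ cong (ℚ._+ 1ℚ) (/1-homo-+ a b) ⟩
  a /1 ℚ.+ b /1 ℚ.+ 1ℚ     ≡⟨ swap (a /1) (b /1) 1ℚ ⟩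
  a /1 ℚ.+ 1ℚ ℚ.+ b /1     ≡⟨ cong (ℚ._+ b /1) (/-suc a 0) ⟨
  suc a /1 ℚ.+ b /1        ∎
  where
  open ≡-Reasoning
  swap : ∀ x y z → x ℚ.+ y ℚ.+ z ≡ x ℚ.+ z ℚ.+ y
  swap = solve 3 (λ x y z → x :+ y :+ z := x :+ z :+ y) refl
    where open Data.Rational.Solver.+-*-Solver

/1-homo-* : ∀ a b → (a * b) /1 ≡ a /1 ℚ.* b /1
/1-homo-* zero    b = sym (ℚ.*-zeroˡ (b /1))
/1-homo-* (suc a) b = begin
  (b + a * b) /1                    ≡⟨ /1-homo-+ b (a * b) ⟩
  b /1 ℚ.+ (a * b) /1               ≡⟨ cong (b /1 ℚ.+_) (/1-homo-* a b) ⟩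
  b /1 ℚ.+ a /1 ℚ.* b /1            ≡⟨ cong (ℚ._+ a /1 ℚ.* b /1) (ℚ.*-identityˡ (b /1)) ⟨
  1ℚ ℚ.* b /1 ℚ.+ a /1 ℚ.* b /1     ≡⟨ ℚ.*-distribʳ-+ (b /1) 1ℚ (a /1) ⟨
  (1ℚ ℚ.+ a /1) ℚ.* b /1            ≡⟨ cong (ℚ._* b /1) (/1-homo-+ 1 a) ⟨
  suc a /1 ℚ.* b /1                 ∎
  where open ≡-Reasoning

-- Raise `2 ^ ⌊log₂ p ⌋ ≤ p` to the power `m` and take logarithms.
⌊log₂p⌋*m≤⌊log₂[p^m]⌋ : ∀ p .{{_ : NonZero p}} m → ⌊log₂ p ⌋ * m ≤ ⌊log₂ (p ^ m) ⌋
⌊log₂p⌋*m≤⌊log₂[p^m]⌋ p m = begin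
  ⌊log₂ p ⌋ * m                 ≡⟨ ⌊log₂[2^n]⌋≡n (⌊log₂ p ⌋ * m) ⟨
  ⌊log₂ 2 ^ (⌊log₂ p ⌋ * m) ⌋   ≡⟨ cong ⌊log₂_⌋ (^-*-assoc 2 ⌊log₂ p ⌋ m) ⟨
  ⌊log₂ (2 ^ ⌊log₂ p ⌋) ^ m ⌋   ≤⟨ ⌊log₂⌋-mono-≤ (^-monoˡ-≤ m (2^⌊log₂n⌋≤n p)) ⟩
  ⌊log₂ (p ^ m) ⌋               ∎
  where open ≤-Reasoning

-- The bound holds for every approximant of `log₂ p` and not just in the limit, so the final
-- inequality can be checked index by index.
⌊log₂⌋≤log₂ : ∀ p .{{_ : NonZero p}} k → (⌊log₂ p ⌋ /1) ℚ.≤ seq (log₂ p) k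
⌊log₂⌋≤log₂ p k = /-mono ⌊log₂ p ⌋ ⌊log₂ (p ^ suc k) ⌋ 0 k
  (≤-trans (⌊log₂p⌋*m≤⌊log₂[p^m]⌋ p (suc k)) (≤-reflexive (sym (*-identityʳ _))))

sum≤∑ : ∀ {n} (f : Fin n → ℕ) (g : Fin n → ℝ) k →
        (∀ i → (f i /1) ℚ.≤ seq (g i) k) → (sum f /1) ℚ.≤ seq (∑ g) k
sum≤∑ {zero}  f g k f≤g = ℚ.≤-refl
sum≤∑ {suc n} f g k f≤g = ℚ.≤-trans (ℚ.≤-reflexive (/1-homo-+ (f Fin.zero) (sum (f ∘ Fin.suc))))
  (ℚ.+-mono-≤ (f≤g Fin.zero) (sum≤∑ (f ∘ Fin.suc) (g ∘ Fin.suc) k (f≤g ∘ Fin.suc)))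

≤-pointwise⇒≤ᴿ : ∀ {x y} → (∀ k → seq x k ℚ.≤ seq y k) → x ≤ᴿ y
≤-pointwise⇒≤ᴿ {x} {y} x≤y δ δ>0 = 0 , λ k _ → begin
  seq x k           ≤⟨ x≤y k ⟩
  seq y k           ≡⟨ ℚ.+-identityʳ (seq y k) ⟨
  seq y k ℚ.+ 0ℚ    ≤⟨ ℚ.+-monoʳ-≤ (seq y k) (ℚ.<⇒≤ δ>0) ⟩
  seq y k ℚ.+ δ     ∎
  where open ℚ.≤-Reasoning

lemmaB1 : ∃[ C ] (0ᴿ <ᴿ C ×
    (∀ (ε μ₁ μ₂ : ℝ) → 0ᴿ <ᴿ ε → ε ≤ᴿ 1ᴿ → 1ᴿ ≤ᴿ μ₁ → 1ᴿ ≤ᴿ μ₂ →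
    (I : Instance ε μ₁ μ₂) (S : Schedule I) → IsBalancedMLF I S →
    (T : ℕ) →
    fromℕ (Schedule.preemptions S T)
    ≤ᴿ C *ᴿ ∑ (λ j → 1ᴿ +ᴿ Instance.log₂p I j)))
-- Positivity of the constant is witnessed by the gap 1, valid from index 0 on.
lemmaB1 = fromℕ 5 , (1ℚ , ℚ.positive⁻¹ 1ℚ , 0 , λ _ _ → from-yes (0ℚ ℚ.+ 1ℚ ℚ.≤? 5 /1)) ,
  λ ε μ₁ μ₂ _ _ _ _ I S B T →
    let open Instance I
        Σ = sum (λ j → 1 + ⌊log₂ p j ⌋)
        bound = λ j → 1ᴿ +ᴿ log₂p j
        summand = λ k j → ℚ.≤-trans (ℚ.≤-reflexive (/1-homo-+ 1 ⌊log₂ p j ⌋))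
          (ℚ.+-monoʳ-≤ 1ℚ (⌊log₂⌋≤log₂ (p j) {{>-nonZero (p≥1 j)}} k))
    in ≤-pointwise⇒≤ᴿ {fromℕ (Schedule.preemptions S T)} {fromℕ 5 *ᴿ ∑ bound} λ k →
      let open ℚ.≤-Reasoning in begin
      Schedule.preemptions S T /1   ≤⟨ /1-mono (preemptions≤ S B T) ⟩
      (5 * Σ) /1                    ≡⟨ /1-homo-* 5 Σ ⟩
      5 /1 ℚ.* Σ /1                 ≤⟨ ℚ.*-monoˡ-≤-nonNeg (5 /1) (sum≤∑ _ bound k (summand k)) ⟩
      5 /1 ℚ.* seq (∑ bound) k      ∎
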